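{- There exists an absolute constant $d_0$ such that the following holds. If $G$ is a finite simple graph with average degree at least $d_0$, such that $G$ has no isolated edge (no connected component isomorphic to $K_2$) and at most one isolated vertex, then $G$ is antimagic.
   Context: For a graph $G=(V,E)$ and an edge colouring $f:E\to\mathbb N$, the induced colour (sum) of a vertex $v$ is $\sum_{e\ni v} f(e)$. A graph $G=(V,E)$ is called antimagic if there is a bijection $f:E\to\{1,\dots,|E|\}$ such that the induced sums at distinct vertices are distinct. -}

module Defs where

open import Data.Nat using (ℕ; zero; suc; _+_; _*_; _≤_)
open import Data.Bool using (Bool; true; false; if_then_else_)
open import Data.Fin using (Fin; toℕ; _<_; _≟_)
open import Data.Fin.Properties using (<-cmp)
open import Data.Product using (Σ; _×_; _,_; ∃)
open import Data.List using (List; map; length; filter)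
open import Data.Nat.ListAction using (sum)
open import Data.List using () renaming (allFin to allFinL)
open import Relation.Binary.PropositionalEquality using (_≡_; _≢_)
open import Relation.Binary.Definitions using (tri<; tri≈; tri>)
open import Relation.Nullary using (¬_)
open import Function.Bundles using (_⤖_; Bijection)

record SimpleGraph (n : ℕ) : Set where
  field
    adj    : Fin n → Fin n → Bool
    sym    : ∀ u v → adj u v ≡ adj v u
    irrefl : ∀ v → adj v v ≡ false
open SimpleGraph public

module _ {n : ℕ} (G : SimpleGraph n) where

  Edge : Set
  Edge = Σ (Fin n) λ u → Σ (Fin n) λ v → (u < v) × (adj G u v ≡ true)

  nbrs : Fin n → List (Fin n)
  nbrs v = filter (λ u → Data.Bool._≟_ (adj G v u) true) (allFinL n)

  degree : Fin n → ℕ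
  degree v = length (nbrs v)

  numEdges : ℕ
  numEdges = length (Data.List.concatMap
    (λ u → filter (λ v → Data.Fin._<?_ u v) (nbrs u)) (allFinL n))

  edgeLabel : (Edge → ℕ) → Fin n → Fin n → ℕ
  edgeLabel f v u with Data.Bool._≟_ (adj G v u) true
  ... | Relation.Nullary.no _ = 0
  ... | Relation.Nullary.yes a with <-cmp v u
  ...   | tri< v<u _ _ = f (v , u , v<u , a)
  ...   | tri≈ _ _ _   = 0
  ...   | tri> _ _ u<v = f (u , v , u<v , Relation.Binary.PropositionalEquality.trans (sym G u v) a)

  inducedSum : (Edge → ℕ) → Fin n → ℕ
  inducedSum f v = sum (map (edgeLabel f v) (nbrs v))

  -- antimagic: a bijection E → {1,…,|E|} (encoded as Fin |E|, value i ↦ i+1)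
  -- with pairwise distinct induced sums
  IsAntimagic : Set
  IsAntimagic = Σ (Edge ⤖ Fin numEdges) λ f →
    ∀ u v → u ≢ v →
      inducedSum (λ e → suc (toℕ (Bijection.to f e))) u
        ≢ inducedSum (λ e → suc (toℕ (Bijection.to f e))) v

  isolatedVertex : Fin n → Set
  isolatedVertex v = degree v ≡ 0

  -- a connected component isomorphic to K₂: adjacent u,v both of degree 1
  isolatedEdge : Fin n → Fin n → Set
  isolatedEdge u v = (adj G u v ≡ true) × (degree u ≡ 1) × (degree v ≡ 1)

  NoIsolatedEdge : Set
  NoIsolatedEdge = ∀ u v → ¬ isolatedEdge u v

  AtMostOneIsolatedVertex : Set
  AtMostOneIsolatedVertex = ∀ u v → isolatedVertex u → isolatedVertex v → u ≡ v

  AvgDegreeAtLeast : ℕ → Set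
  AvgDegreeAtLeast d = d * n ≤ sum (map degree (allFinL n))

{-# OPTIONS --safe #-}
module Submission where

-- Start from any bijective labelling and decrease the number of colliding pairs of vertices.
-- Suppose u and v collide and e is an edge at u but not at v (it exists up to exchanging u and v).
-- Exchanging the label of an edge f with that of another edge r moves the sums at the ends of f
-- by an amount that determines r, so all but O(n) choices of r avoid every coincidence there. At
-- the ends of r the moved sums can systematically hit existing sums, but on average over the
-- labels ℓ of f this concerns only O(n) edges r; hence all but O(n) edges f are good: some
-- exchange with an edge r creates no new collision and separates the ends of f from all other
-- vertices.
-- The edge e itself need not be good. As |E| is a large multiple of n, there is a good edge
-- g = pq away from e such that p and q lie on two further good edges each. First exchange the
-- labels of e and g. Now e carries a good label and can be refreshed, and so can the two further
-- edges at p and at q; together they repair whatever collisions the label of e caused at p and q.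

open import Defs renaming (sym to adj-sym)
open import Axiom.UniquenessOfIdentityProofs using (module Decidable⇒UIP)
import Data.Bool as B
open import Data.Bool using (true)
open import Data.Fin using (Fin; zero; suc; toℕ)
import Data.Fin as F
import Data.Fin.Properties as F
open import Data.Fin.Permutation as Perm
  using (Permutation′; transpose; _∘ₚ_; _⟨$⟩ʳ_; _⟨$⟩ˡ_; inverseˡ; inverseʳ)
import Data.Fin.Permutation.Components as PC
open import Data.List using (List; []; _∷_; length; map; filter; tabulate; concatMap; lookup; allFin)
open import Data.List.Properties using (length-map; map-concatMap; concatMap-cong; map-tabulate)
open import Data.List.Membership.Propositional using (mapWith∈) renaming (_∈_ to _∈ₗ_)
open import Data.List.Membership.Propositional.Properties
  using (map-mapWith∈; mapWith∈-id; ∈-filter⁺; ∈-filter⁻; ∈-lookup; ∈-allFin; ∈-concatMap⁺)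
open import Data.List.Relation.Unary.All as All using (All; []; _∷_)
import Data.List.Relation.Unary.All.Properties as All
open import Data.List.Relation.Unary.AllPairs as AllPairs using ([]; _∷_)
import Data.List.Relation.Unary.AllPairs.Properties as AllPairs
open import Data.List.Relation.Unary.Any as Any using ()
open import Data.List.Relation.Unary.Any.Properties using (lookup-index; mapWith∈⁺; mapWith∈⁻)
open import Data.List.Relation.Unary.Unique.Propositional using (Unique)
import Data.List.Relation.Unary.Unique.Propositional.Properties as Unique
open import Data.Nat
open import Data.Nat.Induction using (<-wellFounded)
import Data.Nat.ListAction as L
open import Data.Nat.Properties
open import Data.Nat.Tactic.RingSolver using (solve-∀)
open import Data.Product using (Σ; _×_; _,_; ∃; ∃₂; proj₁; proj₂)
open import Data.Sum using (_⊎_; inj₁; inj₂)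
open import Function using (_∘_; _⤖_; mk⤖)
open import Induction.WellFounded using (Acc; acc)
open import Relation.Binary.Definitions using (tri<; tri≈; tri>)
open import Relation.Binary.PropositionalEquality
open import Relation.Nullary using (¬_; Dec; yes; no; contradiction; ¬?)
open import Relation.Nullary.Decidable using (_×-dec_; _⊎-dec_; dec-true; dec-false)
import Algebra.Properties.Semiring.Sum +-*-semiring as S

-- Indicator values of decidable propositions, and finite sums.

⟦_⟧ : ∀ {p} {P : Set p} → Dec P → ℕ
⟦ yes _ ⟧ = 1
⟦ no _ ⟧ = 0

⟦⟧≤1 : ∀ {p} {P : Set p} (d : Dec P) → ⟦ d ⟧ ≤ 1
⟦⟧≤1 (yes _) = s≤s z≤n
⟦⟧≤1 (no _) = z≤n

⟦⟧-true : ∀ {p} {P : Set p} (d : Dec P) → P → ⟦ d ⟧ ≡ 1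
⟦⟧-true (yes _) _ = refl
⟦⟧-true (no ¬p) p = contradiction p ¬p

⟦⟧-false : ∀ {p} {P : Set p} (d : Dec P) → ¬ P → ⟦ d ⟧ ≡ 0
⟦⟧-false (yes p) ¬p = contradiction p ¬p
⟦⟧-false (no _) _ = refl

⟦⟧≡0 : ∀ {p} {P : Set p} (d : Dec P) → ⟦ d ⟧ ≡ 0 → ¬ P
⟦⟧≡0 (no ¬p) _ = ¬p

<⟦⟧*⟦⟧ : ∀ {p q} {P : Set p} {Q : Set q} (d : Dec P) (d′ : Dec Q) {x} →
         x < ⟦ d ⟧ * ⟦ d′ ⟧ → x ≡ 0 × P × Q
<⟦⟧*⟦⟧ (yes p) (yes q) lt = n<1⇒n≡0 lt , p , q

⟦⟧-mono : ∀ {p q} {P : Set p} {Q : Set q} (d : Dec P) (d′ : Dec Q) →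
          (P → Q) → ⟦ d ⟧ ≤ ⟦ d′ ⟧
⟦⟧-mono (yes p) d′ f = ≤-reflexive (sym (⟦⟧-true d′ (f p)))
⟦⟧-mono (no _)  d′ f = z≤n

⟦⟧-cong : ∀ {p q} {P : Set p} {Q : Set q} (d : Dec P) (d′ : Dec Q) →
          (P → Q) → (Q → P) → ⟦ d ⟧ ≡ ⟦ d′ ⟧
⟦⟧-cong (yes p) d′ f g = sym (⟦⟧-true d′ (f p))
⟦⟧-cong (no ¬p) d′ f g = sym (⟦⟧-false d′ (¬p ∘ g))

⟦≤⟧* : ∀ x c → ⟦ x ≤? c ⟧ * x ≤ c
⟦≤⟧* x c with x ≤? c
... | yes x≤c = ≤-trans (≤-reflexive (*-identityˡ x)) x≤c
... | no _    = z≤n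

-- Pointwise form of Markov's inequality.
*⟦<⟧ : ∀ a b → a * ⟦ a <? b ⟧ ≤ b
*⟦<⟧ a b with a <? b
... | yes a<b = ≤-trans (≤-reflexive (*-identityʳ a)) (<⇒≤ a<b)
... | no _    = ≤-trans (≤-reflexive (*-zeroʳ a)) z≤n

-- Opaque, so that the length of a sum can be inferred from its summand.
opaque
  sum : ∀ {n} → (Fin n → ℕ) → ℕ
  sum = S.sum

  sum-cong-≗ : ∀ {n} {f g : Fin n → ℕ} → f ≗ g → sum f ≡ sum g
  sum-cong-≗ = S.sum-cong-≗

  ∑-distrib-+ : ∀ {n} (f g : Fin n → ℕ) → sum (λ i → f i + g i) ≡ sum f + sum g
  ∑-distrib-+ = S.∑-distrib-+

  ∑-comm : ∀ {m n} (f : Fin m → Fin n → ℕ) →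
           sum (λ i → sum (λ j → f i j)) ≡ sum (λ j → sum (λ i → f i j))
  ∑-comm = S.∑-comm

  *-distribˡ-sum : ∀ {n} c (f : Fin n → ℕ) → c * sum f ≡ sum (λ i → c * f i)
  *-distribˡ-sum = S.*-distribˡ-sum

  *-distribʳ-sum : ∀ {n} c (f : Fin n → ℕ) → sum f * c ≡ sum (λ i → f i * c)
  *-distribʳ-sum = S.*-distribʳ-sum

  sum-mono : ∀ {n} {f g : Fin n → ℕ} → (∀ i → f i ≤ g i) → sum f ≤ sum g
  sum-mono {zero}  f≤g = z≤n
  sum-mono {suc n} f≤g = +-mono-≤ (f≤g zero) (sum-mono (f≤g ∘ suc))

  sum-mono-< : ∀ {n} {f g : Fin n → ℕ} → (∀ i → f i ≤ g i) →
               ∀ i → f i < g i → sum f < sum g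
  sum-mono-< f≤g zero    f<g = +-mono-<-≤ f<g (sum-mono (f≤g ∘ suc))
  sum-mono-< f≤g (suc i) f<g = +-mono-≤-< (f≤g zero) (sum-mono-< (f≤g ∘ suc) i f<g)

  sum-<⇒∃ : ∀ {n} {f g : Fin n → ℕ} → sum f < sum g → ∃ λ i → f i < g i
  sum-<⇒∃ {suc n} {f} {g} lt with f zero <? g zero
  ... | yes f<g = zero , f<g
  ... | no  f≮g with sum-<⇒∃ {n} {f ∘ suc} {g ∘ suc}
                     (≰⇒> λ le → <⇒≱ lt (+-mono-≤ (≮⇒≥ f≮g) le))
  ...   | i , f<g = suc i , f<g

  sum-const : ∀ {n} c → sum {n} (λ _ → c) ≡ n * c
  sum-const {zero}  c = refl
  sum-const {suc n} c = cong (c +_) (sum-const {n} c)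

  sum-≤ : ∀ {n} {f : Fin n → ℕ} c → (∀ i → f i ≤ c) → sum f ≤ n * c
  sum-≤ {n} c f≤c = ≤-trans (sum-mono f≤c) (≤-reflexive (sum-const {n} c))

  term≤sum : ∀ {n} (f : Fin n → ℕ) i → f i ≤ sum f
  term≤sum f zero    = m≤m+n _ _
  term≤sum f (suc i) = ≤-trans (term≤sum (f ∘ suc) i) (m≤n+m _ _)

  sum≡0 : ∀ {n} {f : Fin n → ℕ} → sum f ≡ 0 → ∀ i → f i ≡ 0
  sum≡0 {f = f} eq i = n≤0⇒n≡0 (≤-trans (term≤sum f i) (≤-reflexive eq))

  sum-pick : ∀ {n} (f : Fin n → ℕ) j → sum (λ i → ⟦ i F.≟ j ⟧ * f i) ≡ f j
  sum-pick {suc n} f zero = trans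
    (cong₂ _+_ (*-identityˡ (f zero)) (trans (sum-const {n} 0) (*-zeroʳ n))) (+-identityʳ _)
  sum-pick {suc n} f (suc j) = trans
    (sum-cong-≗ λ i → cong (_* f (suc i)) (⟦⟧-cong (suc i F.≟ suc j) (i F.≟ j) (λ { refl → refl }) (cong suc)))
    (sum-pick (f ∘ suc) j)

  sum-unique : ∀ {n p} {P : Fin n → Set p} (P? : ∀ i → Dec (P i)) →
               (∀ i j → P i → P j → i ≡ j) → sum (λ i → ⟦ P? i ⟧) ≤ 1
  sum-unique {zero}  P? uniq = z≤n
  sum-unique {suc n} P? uniq with P? zero
  ... | yes p = s≤s (≤-reflexive (trans
        (sum-cong-≗ λ i → ⟦⟧-false (P? (suc i)) λ q → contradiction (uniq zero (suc i) p q) λ ())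
        (trans (sum-const {n} 0) (*-zeroʳ n))))
  ... | no _ = sum-unique (P? ∘ suc) (λ i j p q → F.suc-injective (uniq (suc i) (suc j) p q))

sum-single : ∀ {n} (j : Fin n) → sum (λ i → ⟦ i F.≟ j ⟧) ≡ 1
sum-single j = trans (sum-cong-≗ (λ i → sym (*-identityʳ _))) (sum-pick (λ _ → 1) j)

-- Otherwise all `n` terms would be at least 1. With terms that count the objections to an index,
-- this is the union bound behind the choices made in `step` and `centre`.
vanishes : ∀ {n} (f : Fin n → ℕ) → sum f < n → ∃ λ i → f i ≡ 0
vanishes {n} f lt =
  let i , fi<1 = sum-<⇒∃ {f = f} {g = λ _ → 1}
        (≤-trans lt (≤-reflexive (sym (trans (sum-const {n} 1) (*-identityʳ n)))))
  in i , n<1⇒n≡0 fi<1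

-- Each side adds to one family the terms of the other at the two exceptional indices, which
-- replaces subtraction in ℕ. Once these terms are picked out by indicators, the two sides agree
-- index by index.
sum-except : ∀ {n} (x y : Fin n → ℕ) {i j} → i ≢ j →
             (∀ k → k ≢ i → k ≢ j → x k ≡ y k) →
             sum x + y i + y j ≡ sum y + x i + x j
sum-except x y {i} {j} i≢j x≡y = begin
  sum x + y i + y j
    ≡⟨ cong₂ (λ a b → sum x + a + b) (sym (sum-pick y i)) (sym (sum-pick y j)) ⟩
  sum x + sum (λ k → ⟦ k F.≟ i ⟧ * y k) + sum (λ k → ⟦ k F.≟ j ⟧ * y k)
    ≡⟨ sym (merge x y) ⟩
  sum (λ k → x k + ⟦ k F.≟ i ⟧ * y k + ⟦ k F.≟ j ⟧ * y k)
    ≡⟨ sum-cong-≗ pointwise ⟩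
  sum (λ k → y k + ⟦ k F.≟ i ⟧ * x k + ⟦ k F.≟ j ⟧ * x k)
    ≡⟨ merge y x ⟩
  sum y + sum (λ k → ⟦ k F.≟ i ⟧ * x k) + sum (λ k → ⟦ k F.≟ j ⟧ * x k)
    ≡⟨ cong₂ (λ a b → sum y + a + b) (sum-pick x i) (sum-pick x j) ⟩
  sum y + x i + x j ∎
  where
  open ≡-Reasoning
  merge : ∀ a b → sum (λ k → a k + ⟦ k F.≟ i ⟧ * b k + ⟦ k F.≟ j ⟧ * b k)
        ≡ sum a + sum (λ k → ⟦ k F.≟ i ⟧ * b k) + sum (λ k → ⟦ k F.≟ j ⟧ * b k)
  merge a b = trans (∑-distrib-+ (λ k → a k + ⟦ k F.≟ i ⟧ * b k) _)
                    (cong (_+ _) (∑-distrib-+ a _))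
  exchangeˡ : ∀ a b → a + (b + 0) + 0 ≡ b + (a + 0) + 0
  exchangeˡ = solve-∀
  exchangeʳ : ∀ a b → a + 0 + (b + 0) ≡ b + 0 + (a + 0)
  exchangeʳ = solve-∀
  pointwise : ∀ k → x k + ⟦ k F.≟ i ⟧ * y k + ⟦ k F.≟ j ⟧ * y k
                  ≡ y k + ⟦ k F.≟ i ⟧ * x k + ⟦ k F.≟ j ⟧ * x k
  pointwise k with k F.≟ i | k F.≟ j
  ... | yes refl | yes refl = contradiction refl i≢j
  ... | yes _    | no _     = exchangeˡ (x k) (y k)
  ... | no _     | yes _    = exchangeʳ (x k) (y k)
  ... | no k≢i   | no k≢j   = cong (λ a → a + 0 + 0) (x≡y k k≢i k≢j)

-- Graphs with numbered edges, and exchanges of labels.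

record Graph (n m : ℕ) : Set where
  field
    src tgt : Fin m → Fin n
    src≢tgt : ∀ r → src r ≢ tgt r

  _∈_ : Fin n → Fin m → Set
  w ∈ r = w ≡ src r ⊎ w ≡ tgt r

  _∈?_ : ∀ w r → Dec (w ∈ r)
  w ∈? r = (w F.≟ src r) ⊎-dec (w F.≟ tgt r)

  inc : Fin n → Fin m → ℕ
  inc w r = ⟦ w ∈? r ⟧

  field
    simple : ∀ {r r′ w w′} → w ≢ w′ → w ∈ r → w′ ∈ r → w ∈ r′ → w′ ∈ r′ → r ≡ r′
    deg≤n  : ∀ w → sum (inc w) ≤ n

module Labellings {n m : ℕ} (G : Graph n m) where
  open Graph G

  inc-split : ∀ w r → inc w r ≡ ⟦ w F.≟ src r ⟧ + ⟦ w F.≟ tgt r ⟧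
  inc-split w r with w F.≟ src r | w F.≟ tgt r
  ... | yes p | yes q = contradiction (trans (sym p) q) (src≢tgt r)
  ... | yes _ | no _  = refl
  ... | no _  | yes _ = refl
  ... | no _  | no _  = refl

  ∑-inc : ∀ r f → sum (λ w → inc w r * f w) ≡ f (src r) + f (tgt r)
  ∑-inc r f = begin
    sum (λ w → inc w r * f w)
      ≡⟨ sum-cong-≗ (λ w → trans (cong (_* f w) (inc-split w r)) (*-distribʳ-+ (f w) ⟦ w F.≟ src r ⟧ _)) ⟩
    sum (λ w → ⟦ w F.≟ src r ⟧ * f w + ⟦ w F.≟ tgt r ⟧ * f w)
      ≡⟨ ∑-distrib-+ _ _ ⟩
    sum (λ w → ⟦ w F.≟ src r ⟧ * f w) + sum (λ w → ⟦ w F.≟ tgt r ⟧ * f w)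
      ≡⟨ cong₂ _+_ (sum-pick f (src r)) (sum-pick f (tgt r)) ⟩
    f (src r) + f (tgt r) ∎
    where open ≡-Reasoning

  ∑-inc-≤ : ∀ r {f c} → (∀ w → f w ≤ c) → sum (λ w → inc w r * f w) ≤ 2 * c
  ∑-inc-≤ r {f} {c} f≤c = begin
    sum (λ w → inc w r * f w) ≡⟨ ∑-inc r f ⟩
    f (src r) + f (tgt r)     ≤⟨ +-mono-≤ (f≤c _) (f≤c _) ⟩
    c + c                     ≡⟨ cong (c +_) (sym (+-identityʳ c)) ⟩
    2 * c                     ∎
    where open ≤-Reasoning

  inc≤1 : ∀ w r → inc w r ≤ 1
  inc≤1 w r = ⟦⟧≤1 (w ∈? r)

  inc-∈ : ∀ {w r} → w ∈ r → inc w r ≡ 1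
  inc-∈ {w} {r} = ⟦⟧-true (w ∈? r)

  inc-∉ : ∀ {w r} → ¬ w ∈ r → inc w r ≡ 0
  inc-∉ {w} {r} = ⟦⟧-false (w ∈? r)

  inc*≡0 : ∀ {f : Fin n → ℕ} r → sum (λ w → inc w r * f w) ≡ 0 → ∀ {w} → w ∈ r → f w ≡ 0
  inc*≡0 {f} r eq {w} w∈r = trans (sym (trans (cong (_* f w) (inc-∈ w∈r)) (*-identityˡ (f w))))
                              (sum≡0 eq w)

  -- Edges being numbers, a bijection onto the labels is a permutation, and exchanging two labels is
  -- composition with a transposition.
  Labelling : Set
  Labelling = Permutation′ m

  lab : Labelling → Fin m → ℕ
  lab π i = suc (toℕ (π ⟨$⟩ʳ i))

  lab-injective : ∀ π {i j} → lab π i ≡ lab π j → i ≡ j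
  lab-injective π eq = trans (sym (inverseˡ π))
    (trans (cong (π ⟨$⟩ˡ_) (F.toℕ-injective (suc-injective eq))) (inverseˡ π))

  swap : Fin m → Fin m → Labelling → Labelling
  swap f r π = transpose f r ∘ₚ π

  lab-swapˡ : ∀ f r π → lab (swap f r π) f ≡ lab π r
  lab-swapˡ f r π = cong (lab π) eq
    where
    eq : PC.transpose f r f ≡ r
    eq rewrite dec-true (f F.≟ f) refl = refl

  lab-swapʳ : ∀ f r π → lab (swap f r π) r ≡ lab π f
  lab-swapʳ f r π = cong (lab π) eq
    where
    eq : PC.transpose f r r ≡ f
    eq with r F.≟ f
    ... | yes r≡f = r≡f
    ... | no _ rewrite dec-true (r F.≟ r) refl = refl

  lab-swap : ∀ {f r} π {k} → k ≢ f → k ≢ r → lab (swap f r π) k ≡ lab π k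
  lab-swap {f} {r} π {k} k≢f k≢r = cong (lab π) eq
    where
    eq : PC.transpose f r k ≡ k
    eq rewrite dec-false (k F.≟ f) k≢f | dec-false (k F.≟ r) k≢r = refl

  opaque
    vsum : Labelling → Fin n → ℕ
    vsum π w = sum (λ i → inc w i * lab π i)

    vsum-def : ∀ π w → vsum π w ≡ sum (λ i → inc w i * lab π i)
    vsum-def π w = refl

    vsum-swap : ∀ {f r} π → f ≢ r → ∀ w →
      vsum (swap f r π) w + inc w f * lab π f + inc w r * lab π r
        ≡ vsum π w + inc w f * lab π r + inc w r * lab π f
    vsum-swap {f} {r} π f≢r w = begin
      vsum (swap f r π) w + inc w f * lab π f + inc w r * lab π r
        ≡⟨ sum-except _ _ f≢r (λ k k≢f k≢r → cong (inc w k *_) (lab-swap π k≢f k≢r)) ⟩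
      vsum π w + inc w f * lab (swap f r π) f + inc w r * lab (swap f r π) r
        ≡⟨ cong₂ (λ a b → vsum π w + inc w f * a + inc w r * b) (lab-swapˡ f r π) (lab-swapʳ f r π) ⟩
      vsum π w + inc w f * lab π r + inc w r * lab π f ∎
      where open ≡-Reasoning

  module _ {f r : Fin m} (π : Labelling) (f≢r : f ≢ r) {w : Fin n} where
    private
      shift : ∀ {a b} → inc w f ≡ a → inc w r ≡ b →
        vsum (swap f r π) w + a * lab π f + b * lab π r
          ≡ vsum π w + a * lab π r + b * lab π f
      shift refl refl = vsum-swap π f≢r w
      unit : ∀ x y → x + 1 * y + 0 ≡ x + y
      unit = solve-∀
      unit′ : ∀ x y → x + 0 + 1 * y ≡ x + y
      unit′ = solve-∀
      zeros : ∀ x → x + 0 + 0 ≡ x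
      zeros = solve-∀

    vsum-swapˡ : w ∈ f → ¬ w ∈ r → vsum (swap f r π) w + lab π f ≡ vsum π w + lab π r
    vsum-swapˡ p q = trans (sym (unit (vsum (swap f r π) w) _))
      (trans (shift (inc-∈ p) (inc-∉ q)) (unit (vsum π w) _))

    vsum-swapʳ : ¬ w ∈ f → w ∈ r → vsum (swap f r π) w + lab π r ≡ vsum π w + lab π f
    vsum-swapʳ p q = trans (sym (unit′ (vsum (swap f r π) w) _))
      (trans (shift (inc-∉ p) (inc-∈ q)) (unit′ (vsum π w) _))

    vsum-swap-∉ : ¬ w ∈ f → ¬ w ∈ r → vsum (swap f r π) w ≡ vsum π w
    vsum-swap-∉ p q = trans (sym (zeros _)) (trans (shift (inc-∉ p) (inc-∉ q)) (zeros _))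

  -- Coincidences caused by a single exchange.

  -- conflict π ℓ r counts the coincidences created at the ends of r by relabelling r with ℓ.
  hit : Labelling → ℕ → Fin m → Fin n → Fin n → ℕ
  hit π ℓ r w w′ = ⟦ vsum π w + ℓ ≟ vsum π w′ + lab π r ⟧

  conflict : Labelling → ℕ → Fin m → ℕ
  conflict π ℓ r = sum (λ w → inc w r * sum (hit π ℓ r w))

  conflicts : Labelling → ℕ → ℕ
  conflicts π ℓ = sum (conflict π ℓ)

  -- For fixed `w`, `w′` and `ℓ` the equation determines the label of `r`, hence `r`.
  hit-unique : ∀ π ℓ w w′ → sum (λ r → hit π ℓ r w w′) ≤ 1
  hit-unique π ℓ w w′ = sum-unique _ λ i j p q →
    lab-injective π (+-cancelˡ-≡ (vsum π w′) _ _ (trans (sym p) q))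

  hit≤1 : ∀ π ℓ r w w′ → hit π ℓ r w w′ ≤ 1
  hit≤1 π ℓ r w w′ = ⟦⟧≤1 (vsum π w + ℓ ≟ vsum π w′ + lab π r)

  -- An induced sum shared after the step was already shared before it, and by vertices on the
  -- same side of f: the step separates the ends of f from all other vertices.
  Refines : Fin m → Labelling → Labelling → Set
  Refines f π π′ = ∀ {w w′} → vsum π′ w ≡ vsum π′ w′ → vsum π w ≡ vsum π w′ × (w ∈ f → w′ ∈ f)

  module Step (π : Labelling) (f : Fin m) (avoid : Fin m → ℕ) where
    private ℓ = lab π f

    -- The second sum covers collisions with an end of r: there both sums move by lab π r − ℓ,
    -- in opposite directions.
    badAt : Fin n → Fin m → ℕ
    badAt w r = sum (λ w′ → ⟦ vsum π w + lab π r ≟ vsum π w′ + ℓ ⟧)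
              + sum (λ w′ → ⟦ vsum π w + 2 * lab π r ≟ vsum π w′ + 2 * ℓ ⟧)
              + inc w r

    bad : Fin m → ℕ
    bad r = sum (λ w → inc w f * badAt w r) + conflict π ℓ r + avoid r

    -- For each `w′` either equation determines `lab π r`, hence `r`. So each of the two sums
    -- contributes at most n, and the degree of `w` at most n more.
    ∑-badAt : ∀ w → sum (badAt w) ≤ 3 * n
    ∑-badAt w = begin
      sum (badAt w)
        ≡⟨ trans (∑-distrib-+ _ _) (cong (_+ _) (∑-distrib-+ _ _)) ⟩
      sum (λ r → sum (λ w′ → ⟦ vsum π w + lab π r ≟ vsum π w′ + ℓ ⟧))
        + sum (λ r → sum (λ w′ → ⟦ vsum π w + 2 * lab π r ≟ vsum π w′ + 2 * ℓ ⟧))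
        + sum (inc w)
        ≡⟨ cong₂ (λ a b → a + b + sum (inc w)) (∑-comm _) (∑-comm _) ⟩
      sum (λ w′ → sum (λ r → ⟦ vsum π w + lab π r ≟ vsum π w′ + ℓ ⟧))
        + sum (λ w′ → sum (λ r → ⟦ vsum π w + 2 * lab π r ≟ vsum π w′ + 2 * ℓ ⟧))
        + sum (inc w)
        ≤⟨ +-mono-≤ (+-mono-≤
             (sum-≤ 1 λ w′ → sum-unique _ λ i j p q →
               lab-injective π (+-cancelˡ-≡ (vsum π w) _ _ (trans p (sym q))))
             (sum-≤ 1 λ w′ → sum-unique _ λ i j p q →
               lab-injective π (*-cancelˡ-≡ _ _ 2 (+-cancelˡ-≡ (vsum π w) _ _ (trans p (sym q))))))
             (deg≤n w) ⟩
      n * 1 + n * 1 + n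
        ≡⟨ arith n ⟩
      3 * n ∎
      where
      open ≤-Reasoning
      arith : ∀ n → n * 1 + n * 1 + n ≡ 3 * n
      arith = solve-∀

    -- The term 6n stems from the two ends of `f`, with 3n each.
    ∑-bad : sum bad ≤ 6 * n + conflicts π ℓ + sum avoid
    ∑-bad = begin
      sum bad
        ≡⟨ trans (∑-distrib-+ _ _) (cong (_+ _) (∑-distrib-+ _ _)) ⟩
      sum (λ r → sum (λ w → inc w f * badAt w r)) + conflicts π ℓ + sum avoid
        ≡⟨ cong (λ a → a + conflicts π ℓ + sum avoid) (trans (∑-comm _)
             (sum-cong-≗ λ w → sym (*-distribˡ-sum (inc w f) _))) ⟩
      sum (λ w → inc w f * sum (badAt w)) + conflicts π ℓ + sum avoid
        ≤⟨ +-monoˡ-≤ _ (+-monoˡ-≤ _ (∑-inc-≤ f ∑-badAt)) ⟩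
      2 * (3 * n) + conflicts π ℓ + sum avoid
        ≡⟨ cong (λ a → a + conflicts π ℓ + sum avoid) (sym (*-assoc 2 3 n)) ⟩
      6 * n + conflicts π ℓ + sum avoid ∎
      where open ≤-Reasoning

    module _ {r : Fin m} (bad≡0 : bad r ≡ 0) where
      private
        all≡0 : sum (λ w → inc w f * badAt w r) + conflict π ℓ r ≡ 0
        all≡0 = m+n≡0⇒m≡0 (sum (λ w → inc w f * badAt w r) + conflict π ℓ r) bad≡0
        at : ∀ {w} → w ∈ f → badAt w r ≡ 0
        at = inc*≡0 f (m+n≡0⇒m≡0 _ all≡0)

      avoided : avoid r ≡ 0
      avoided = m+n≡0⇒n≡0 (sum (λ w → inc w f * badAt w r) + conflict π ℓ r) bad≡0

      private
        disjoint : ∀ {w} → w ∈ f → ¬ w ∈ r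
        disjoint {w} w∈f = ⟦⟧≡0 (w ∈? r) (m+n≡0⇒n≡0 (sum _ + sum _) (at w∈f))

      f≢r : f ≢ r
      f≢r f≡r = disjoint (inj₁ refl) (inj₁ (cong src f≡r))

      private
        old : ∀ {w} → w ∈ f → ∀ w′ → vsum π w + lab π r ≢ vsum π w′ + ℓ
        old {w} w∈f w′ = ⟦⟧≡0 (_ ≟ _) (sum≡0 (m+n≡0⇒m≡0 (sum _) (m+n≡0⇒m≡0 (sum _ + sum _) (at w∈f))) w′)

        two : ∀ {w} → w ∈ f → ∀ w′ → vsum π w + 2 * lab π r ≢ vsum π w′ + 2 * ℓ
        two {w} w∈f w′ = ⟦⟧≡0 (_ ≟ _) (sum≡0 (m+n≡0⇒n≡0 (sum _) (m+n≡0⇒m≡0 (sum _ + sum _) (at w∈f))) w′)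

        new : ∀ {w} → w ∈ r → ∀ w′ → vsum π w + ℓ ≢ vsum π w′ + lab π r
        new w∈r w′ = ⟦⟧≡0 (_ ≟ _) (sum≡0 (inc*≡0 r (m+n≡0⇒n≡0 (sum _) all≡0) w∈r) w′)

        data Kind (w : Fin n) : Set where
          inF  : w ∈ f → vsum (swap f r π) w + ℓ ≡ vsum π w + lab π r → Kind w
          inR  : w ∈ r → ¬ w ∈ f → vsum (swap f r π) w + lab π r ≡ vsum π w + ℓ → Kind w
          rest : ¬ w ∈ f → vsum (swap f r π) w ≡ vsum π w → Kind w

        kind : ∀ w → Kind w
        kind w with w ∈? f | w ∈? r
        ... | yes p | _     = inF p (vsum-swapˡ π f≢r p (disjoint p))
        ... | no ¬p | yes q = inR q ¬p (vsum-swapʳ π f≢r ¬p q)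
        ... | no ¬p | no ¬q = rest ¬p (vsum-swap-∉ π f≢r ¬p ¬q)

        f-rest : ∀ {w w′} → w ∈ f → vsum (swap f r π) w + ℓ ≡ vsum π w + lab π r →
                 vsum (swap f r π) w′ ≡ vsum π w′ → vsum (swap f r π) w ≢ vsum (swap f r π) w′
        f-rest {w} {w′} p a b eq = old p w′ (trans (sym a) (cong (_+ ℓ) (trans eq b)))

        r-rest : ∀ {w w′} → w ∈ r → vsum (swap f r π) w + lab π r ≡ vsum π w + ℓ →
                 vsum (swap f r π) w′ ≡ vsum π w′ → vsum (swap f r π) w ≢ vsum (swap f r π) w′
        r-rest {w} {w′} p a b eq = new p w′ (trans (sym a) (cong (_+ lab π r) (trans eq b)))

        -- The end of `f` gains what the end of `r` loses, so a collision would bridge a gap of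
        -- twice the label difference, which `two` excludes.
        f-r : ∀ {w w′} → w ∈ f → vsum (swap f r π) w + ℓ ≡ vsum π w + lab π r →
              vsum (swap f r π) w′ + lab π r ≡ vsum π w′ + ℓ → vsum (swap f r π) w ≢ vsum (swap f r π) w′
        f-r {w} {w′} p a b eq = two p w′ (begin
          vsum π w + 2 * lab π r                 ≡⟨ double (vsum π w) _ ⟩
          vsum π w + lab π r + lab π r           ≡⟨ cong (_+ lab π r) (sym a) ⟩
          vsum (swap f r π) w + ℓ + lab π r      ≡⟨ cong (λ x → x + ℓ + lab π r) eq ⟩
          vsum (swap f r π) w′ + ℓ + lab π r     ≡⟨ exchange (vsum (swap f r π) w′) ℓ _ ⟩
          vsum (swap f r π) w′ + lab π r + ℓ     ≡⟨ cong (_+ ℓ) b ⟩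
          vsum π w′ + ℓ + ℓ                      ≡⟨ sym (double (vsum π w′) _) ⟩
          vsum π w′ + 2 * ℓ                      ∎)
          where
          open ≡-Reasoning
          double : ∀ a b → a + 2 * b ≡ a + b + b
          double = solve-∀
          exchange : ∀ a b c → a + b + c ≡ a + c + b
          exchange = solve-∀

      -- Vertices of the same kind move by the same amount, so their coincidence is old.
      -- Coincidences between different kinds are ruled out by `old`, `two` and `new`.
      refines : Refines f π (swap f r π)
      refines {w} {w′} eq with kind w | kind w′
      ... | inF p a    | inF q b    =
        +-cancelʳ-≡ (lab π r) _ _ (trans (sym a) (trans (cong (_+ ℓ) eq) b)) , λ _ → q
      ... | inF p a    | inR q _ b  = contradiction eq (f-r p a b)
      ... | inF p a    | rest _ b   = contradiction eq (f-rest p a b)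
      ... | inR p _ a  | inF q b    = contradiction (sym eq) (f-r q b a)
      ... | inR p ¬p a | inR q ¬q b =
        +-cancelʳ-≡ ℓ _ _ (trans (sym a) (trans (cong (_+ lab π r) eq) b)) , λ p → contradiction p ¬p
      ... | inR p _ a  | rest _ b   = contradiction eq (r-rest p a b)
      ... | rest _ a   | inF q b    = contradiction (sym eq) (f-rest q b a)
      ... | rest _ a   | inR q _ b  = contradiction (sym eq) (r-rest q b a)
      ... | rest ¬p a  | rest _ b   = trans (sym a) (trans eq b) , λ p → contradiction p ¬p

    step : 6 * n + conflicts π ℓ + sum avoid < m →
           ∃ λ r → avoid r ≡ 0 × f ≢ r × Refines f π (swap f r π)
    step lt = let r , bad≡0 = vanishes bad (≤-<-trans ∑-bad lt)
              in r , avoided bad≡0 , f≢r bad≡0 , refines bad≡0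

-- Conflict counts: their change under an exchange and their average over all labels.

module _ {n m : ℕ} (G : Graph n m) where
  open Graph G
  open Labellings G

  triple : (Fin m → Fin n → Fin n → ℕ) → ℕ
  triple X = sum λ r → sum λ w → sum (X r w)

  triple-mono : ∀ {X Y} → (∀ r w w′ → X r w w′ ≤ Y r w w′) → triple X ≤ triple Y
  triple-mono le = sum-mono λ r → sum-mono λ w → sum-mono λ w′ → le r w w′

  triple-+ : ∀ X Y → triple (λ r w w′ → X r w w′ + Y r w w′) ≡ triple X + triple Y
  triple-+ X Y = trans
    (sum-cong-≗ λ r → trans (sum-cong-≗ λ w → ∑-distrib-+ (X r w) (Y r w)) (∑-distrib-+ _ _))
    (∑-distrib-+ _ _)

  triple-rotate : ∀ X → triple X ≡ sum λ w → sum λ w′ → sum λ r → X r w w′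
  triple-rotate X = trans (∑-comm _) (sum-cong-≗ λ w → ∑-comm _)

  conflicts-triple : ∀ π ℓ → conflicts π ℓ ≡ triple (λ r w w′ → inc w r * hit π ℓ r w w′)
  conflicts-triple π ℓ = sum-cong-≗ λ r → sum-cong-≗ λ w → *-distribˡ-sum (inc w r) _

  module _ {f g : Fin m} (f≢g : f ≢ g) (π : Labelling) (ℓ : ℕ) where
    private
      π′ = swap f g π

      touched : Fin n → ℕ
      touched w = inc w f + inc w g

      moved : Fin m → ℕ
      moved r = ⟦ r F.≟ f ⟧ + ⟦ r F.≟ g ⟧

      T T′ : Fin m → Fin n → Fin n → ℕ
      T  r w w′ = inc w r * hit π ℓ r w w′
      T′ r w w′ = inc w r * hit π′ ℓ r w w′

      untouched : ∀ w → touched w ≡ 0 → vsum π′ w ≡ vsum π w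
      untouched w eq = vsum-swap-∉ π f≢g
        (⟦⟧≡0 (w ∈? f) (m+n≡0⇒m≡0 (inc w f) eq)) (⟦⟧≡0 (w ∈? g) (m+n≡0⇒n≡0 (inc w f) eq))

      unmoved : ∀ r → moved r ≡ 0 → lab π′ r ≡ lab π r
      unmoved r eq = lab-swap π
        (⟦⟧≡0 (r F.≟ f) (m+n≡0⇒m≡0 ⟦ r F.≟ f ⟧ eq)) (⟦⟧≡0 (r F.≟ g) (m+n≡0⇒n≡0 ⟦ r F.≟ f ⟧ eq))

      -- Either all weights vanish and the term is unchanged, or some weight is at least 1 and its
      -- product with `t′` already covers `t′`.
      dominated : ∀ {t t′} a b c → (a ≡ 0 → b ≡ 0 → c ≡ 0 → t′ ≡ t) →
                  t′ ≤ t + (a * t′ + b * t′ + c * t′)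
      dominated {t} {t′} zero zero zero same = ≤-trans (≤-reflexive (same refl refl refl)) (m≤m+n _ _)
      dominated {t} {t′} (suc a) b c _ =
        ≤-trans (≤-trans (m≤m+n t′ _) (≤-trans (m≤m+n _ (b * t′)) (m≤m+n _ (c * t′)))) (m≤n+m _ t)
      dominated {t} {t′} zero (suc b) c _ =
        ≤-trans (≤-trans (m≤m+n t′ _) (m≤m+n _ (c * t′))) (m≤n+m _ t)
      dominated {t} {t′} zero zero (suc c) _ = ≤-trans (m≤m+n t′ _) (m≤n+m _ t)

      A B C : Fin m → Fin n → Fin n → ℕ
      A r w w′ = touched w * T′ r w w′
      B r w w′ = touched w′ * T′ r w w′
      C r w w′ = moved r * T′ r w w′

      -- The exchange enters the equation only through the sums at `w` and `w′` and the label of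
      -- `r`, so new terms arise only where one of these was changed.
      T′≤ : ∀ r w w′ → T′ r w w′ ≤ T r w w′ +
            (A r w w′ + B r w w′ + C r w w′)
      T′≤ r w w′ = dominated (touched w) (touched w′) (moved r) λ a b c →
        cong (inc w r *_) (cong₂ (λ x y → ⟦ x ≟ y ⟧)
          (cong (_+ ℓ) (untouched w a)) (cong₂ _+_ (untouched w′ b) (unmoved r c)))

      T′≤hit : ∀ r w w′ → T′ r w w′ ≤ hit π′ ℓ r w w′
      T′≤hit r w w′ = ≤-trans (*-monoˡ-≤ _ (inc≤1 w r)) (≤-reflexive (*-identityˡ _))

      ∑-touched : ∀ (X : Fin n → ℕ) → (∀ w → X w ≤ n) → sum (λ w → touched w * X w) ≤ 4 * n
      ∑-touched X X≤ = begin
        sum (λ w → touched w * X w)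
          ≡⟨ trans (sum-cong-≗ λ w → *-distribʳ-+ (X w) (inc w f) (inc w g)) (∑-distrib-+ _ _) ⟩
        sum (λ w → inc w f * X w) + sum (λ w → inc w g * X w)
          ≤⟨ +-mono-≤ (∑-inc-≤ f X≤) (∑-inc-≤ g X≤) ⟩
        2 * n + 2 * n ≡⟨ sym (*-distribʳ-+ n 2 2) ⟩
        4 * n ∎
        where open ≤-Reasoning

      byVertex : ∀ w → sum (λ w′ → sum λ r → T′ r w w′) ≤ n
      byVertex w = ≤-trans (sum-≤ 1 λ w′ → ≤-trans (sum-mono λ r → T′≤hit r w w′) (hit-unique π′ ℓ w w′))
                           (≤-reflexive (*-identityʳ n))

      byVertex′ : ∀ w′ → sum (λ w → sum λ r → T′ r w w′) ≤ n
      byVertex′ w′ = ≤-trans (sum-≤ 1 λ w → ≤-trans (sum-mono λ r → T′≤hit r w w′) (hit-unique π′ ℓ w w′))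
                             (≤-reflexive (*-identityʳ n))

      -- The exchanged edges have four ends, counted with multiplicity. For `w` such an end, each
      -- `w′` is hit by at most one `r`.
      partA : triple A ≤ 4 * n
      partA = begin
        triple A
          ≡⟨ triple-rotate _ ⟩
        sum (λ w → sum λ w′ → sum λ r → touched w * T′ r w w′)
          ≡⟨ (sum-cong-≗ λ w → sym (trans (*-distribˡ-sum (touched w) _)
                (sum-cong-≗ λ w′ → *-distribˡ-sum (touched w) _))) ⟩
        sum (λ w → touched w * sum λ w′ → sum λ r → T′ r w w′)
          ≤⟨ ∑-touched _ byVertex ⟩
        4 * n ∎
        where open ≤-Reasoning

      partB : triple B ≤ 4 * n
      partB = begin
        triple B
          ≡⟨ trans (triple-rotate _) (∑-comm _) ⟩
        sum (λ w′ → sum λ w → sum λ r → touched w′ * T′ r w w′)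
          ≡⟨ (sum-cong-≗ λ w′ → sym (trans (*-distribˡ-sum (touched w′) _)
                (sum-cong-≗ λ w → *-distribˡ-sum (touched w′) _))) ⟩
        sum (λ w′ → touched w′ * sum λ w → sum λ r → T′ r w w′)
          ≤⟨ ∑-touched _ byVertex′ ⟩
        4 * n ∎
        where open ≤-Reasoning

      byEdge : ∀ r → sum (λ w → sum λ w′ → T′ r w w′) ≤ 2 * n
      byEdge r = begin
        sum (λ w → sum λ w′ → T′ r w w′)
          ≡⟨ (sum-cong-≗ λ w → sym (*-distribˡ-sum (inc w r) _)) ⟩
        sum (λ w → inc w r * sum (hit π′ ℓ r w))
          ≤⟨ ∑-inc-≤ r (λ w → ≤-trans (sum-≤ 1 (hit≤1 π′ ℓ r w)) (≤-reflexive (*-identityʳ n))) ⟩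
        2 * n ∎
        where open ≤-Reasoning

      -- Only two edges `r` change their label; each has two ends, and there are n choices of `w′`.
      partC : triple C ≤ 4 * n
      partC = begin
        triple C
          ≡⟨ (sum-cong-≗ λ r → sym (trans (*-distribˡ-sum (moved r) _)
                (sum-cong-≗ λ w → *-distribˡ-sum (moved r) _))) ⟩
        sum (λ r → moved r * sum λ w → sum λ w′ → T′ r w w′)
          ≤⟨ (sum-mono λ r → *-monoʳ-≤ (moved r) (byEdge r)) ⟩
        sum (λ r → moved r * (2 * n))
          ≡⟨ sym (*-distribʳ-sum (2 * n) moved) ⟩
        sum moved * (2 * n)
          ≡⟨ cong (_* (2 * n)) (trans (∑-distrib-+ _ _) (cong₂ _+_ (sum-single f) (sum-single g))) ⟩
        2 * (2 * n) ≡⟨ sym (*-assoc 2 2 n) ⟩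
        4 * n ∎
        where open ≤-Reasoning

    conflicts-swap : conflicts π′ ℓ ≤ conflicts π ℓ + 12 * n
    conflicts-swap = begin
      conflicts π′ ℓ
        ≡⟨ conflicts-triple π′ ℓ ⟩
      triple T′
        ≤⟨ triple-mono T′≤ ⟩
      triple (λ r w w′ → T r w w′ + (A r w w′ + B r w w′ + C r w w′))
        ≡⟨ trans (triple-+ T _) (cong (triple T +_) (trans (triple-+ (λ r w w′ → A r w w′ + B r w w′) C)
            (cong (_+ triple C) (triple-+ A B)))) ⟩
      triple T + (triple A + triple B + triple C)
        ≤⟨ +-monoʳ-≤ (triple T) (+-mono-≤ (+-mono-≤ partA partB) partC) ⟩
      triple T + (4 * n + 4 * n + 4 * n)
        ≡⟨ cong₂ _+_ (sym (conflicts-triple π ℓ)) (arith n) ⟩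
      conflicts π ℓ + 12 * n ∎
      where
      open ≤-Reasoning
      arith : ∀ n → 4 * n + 4 * n + 4 * n ≡ 12 * n
      arith = solve-∀

  -- For fixed `r`, `w` and `w′` the equation determines the label of `h`, so each edge `r`
  -- contributes at most 2n. Hence the conflict count averaged over all labels is at most 2n.
  ∑-conflicts : ∀ π → sum (λ h → conflicts π (lab π h)) ≤ m * (2 * n)
  ∑-conflicts π = begin
    sum (λ h → sum λ r → sum λ w → inc w r * sum (hit π (lab π h) r w))
      ≡⟨ ∑-comm _ ⟩
    sum (λ r → sum λ h → sum λ w → inc w r * sum (hit π (lab π h) r w))
      ≡⟨ (sum-cong-≗ λ r → trans (∑-comm _) (sum-cong-≗ λ w → sym (*-distribˡ-sum (inc w r) _))) ⟩
    sum (λ r → sum λ w → inc w r * sum λ h → sum (hit π (lab π h) r w))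
      ≤⟨ sum-≤ (2 * n) (λ r → ∑-inc-≤ r (bound r)) ⟩
    m * (2 * n) ∎
    where
    open ≤-Reasoning
    bound : ∀ r w → sum (λ h → sum (hit π (lab π h) r w)) ≤ n
    bound r w = begin
      sum (λ h → sum (hit π (lab π h) r w)) ≡⟨ ∑-comm _ ⟩
      sum (λ w′ → sum λ h → hit π (lab π h) r w w′)
        ≤⟨ sum-≤ 1 (λ w′ → sum-unique _ λ i j p q →
             lab-injective π (+-cancelˡ-≡ (vsum π w) _ _ (trans p (sym q)))) ⟩
      n * 1 ≡⟨ *-identityʳ n ⟩
      n ∎

  -- Refreshing a list of edges one after another.

  occurrences : List (Fin m) → Fin m → ℕ
  occurrences []       r = 0
  occurrences (f ∷ fs) r = ⟦ r F.≟ f ⟧ + occurrences fs r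

  ∑-occurrences : ∀ fs → sum (occurrences fs) ≡ length fs
  ∑-occurrences [] = trans (sum-const {m} 0) (*-zeroʳ m)
  ∑-occurrences (f ∷ fs) = trans (∑-distrib-+ _ _) (cong₂ _+_ (sum-single f) (∑-occurrences fs))

  occurrences≡0 : ∀ fs {r} → occurrences fs r ≡ 0 → All (r ≢_) fs
  occurrences≡0 [] _ = []
  occurrences≡0 (f ∷ fs) {r} eq =
    ⟦⟧≡0 (r F.≟ f) (m+n≡0⇒m≡0 ⟦ r F.≟ f ⟧ eq) ∷ occurrences≡0 fs (m+n≡0⇒n≡0 ⟦ r F.≟ f ⟧ eq)

  -- One step uses 6n + length fs edges (Step.∑-bad) and raises later conflict counts by 12n.
  cost : ℕ
  cost = 18 * n + 1

  module _ (c l : ℕ) where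
    open ≤-Reasoning

    first-cost : c + (1 + l) * cost < m → 6 * n + c + l < m
    first-cost lt = begin-strict
      6 * n + c + l                              ≤⟨ m≤m+n _ _ ⟩
      6 * n + c + l + (12 * n + 1 + l * (18 * n)) ≡⟨ arith n c l ⟩
      c + (1 + l) * cost                         <⟨ lt ⟩
      m                                          ∎
      where
      arith : ∀ n c l → 6 * n + c + l + (12 * n + 1 + l * (18 * n)) ≡ c + (1 + l) * (18 * n + 1)
      arith = solve-∀

    later-cost : ∀ {c′} → c′ ≤ c + 12 * n → c + (1 + l) * cost < m → c′ + l * cost < m
    later-cost {c′} c′≤ lt = begin-strict
      c′ + l * cost                        ≤⟨ +-monoˡ-≤ (l * cost) c′≤ ⟩
      c + 12 * n + l * cost                ≤⟨ m≤m+n _ _ ⟩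
      c + 12 * n + l * cost + (6 * n + 1)  ≡⟨ arith n c l ⟩
      c + (1 + l) * cost                   <⟨ lt ⟩
      m                                    ∎
      where
      arith : ∀ n c l → c + 12 * n + l * (18 * n + 1) + (6 * n + 1) ≡ c + (1 + l) * (18 * n + 1)
      arith = solve-∀

  -- `l` counts the refreshing steps still to come, that of `f` included; the inequality reserves
  -- one `cost` for each.
  Light : Labelling → ℕ → Fin m → Set
  Light π l f = conflicts π (lab π f) + l * cost < m

  Fresh : List (Fin m) → Labelling → Labelling → Set
  Fresh fs π π′ = ∀ {w w′} → vsum π′ w ≡ vsum π′ w′ →
    vsum π w ≡ vsum π w′ × All (λ f → w ∈ f → w′ ∈ f) fs

  refresh-first : ∀ π f fs → Light π (1 + length fs) f →
    ∃ λ r → occurrences fs r ≡ 0 × f ≢ r × Refines f π (swap f r π)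
  -- With `occurrences fs` as `avoid`, the exchange partner of `f` is none of the edges still to be
  -- refreshed, so these keep their labels.
  refresh-first π f fs light = Step.step π f (occurrences fs)
    (subst (λ l → 6 * n + conflicts π (lab π f) + l < m) (sym (∑-occurrences fs))
      (first-cost (conflicts π (lab π f)) (length fs) light))

  -- As `h` is neither of the exchanged edges, its label stays and its conflict count rises by at
  -- most 12n, which the released `cost` covers.
  light-swap : ∀ {π f r h l} → f ≢ r → f ≢ h → r ≢ h → Light π (1 + l) h → Light (swap f r π) l h
  light-swap {π} {f} {r} {h} {l} f≢r f≢h r≢h = later-cost (conflicts π (lab π h)) l
    (≤-trans (≤-reflexive (cong (conflicts (swap f r π)) (lab-swap π (≢-sym f≢h) (≢-sym r≢h))))
             (conflicts-swap f≢r π (lab π h)))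

  refresh : ∀ fs π → Unique fs → All (Light π (length fs)) fs → ∃ (Fresh fs π)
  refresh [] π _ _ = π , λ eq → eq , []
  refresh (f ∷ fs) π (f∉fs ∷ unique) (light ∷ lights) =
    let r , avoided , f≢r , refines = refresh-first π f fs light
        lights′ = All.zipWith (λ { ((f≢h , r≢h) , lt) → light-swap {π} {l = length fs} f≢r f≢h r≢h lt })
                    (All.zip (f∉fs , occurrences≡0 fs avoided) , lights)
        π′ , fresh = refresh fs (swap f r π) unique lights′
    in π′ , λ {w} {w′} eq →
         -- Later steps create no coincidence, so one present at the end already held after the
         -- first step and is subject to the separation achieved there.
         let eq₁ , rest = fresh {w} {w′} eq
             eq₀ , here = refines {w} {w′} eq₁
         in eq₀ , here ∷ rest

-- Choice of the auxiliary edges.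

module _ {n m : ℕ} (G : Graph n m) (large : 200 * n ≤ m) where
  open Graph G
  open Labellings G

  module Gadget (π : Labelling) (e : Fin m) where
    n>0 : 0 < n
    n>0 = ≤-trans (s≤s z≤n) (F.toℕ<n (src e))

    m>0 : 0 < m
    m>0 = ≤-trans (s≤s z≤n) (F.toℕ<n e)

    load : Fin m → ℕ
    load h = conflicts π (lab π h)

    -- The threshold of a quarter of `m` leaves three quarters to pay for the exchanges counted in
    -- `light`.
    overloaded : Fin m → ℕ
    overloaded h = ⟦ m <? 4 * load h ⟧

    meets : Fin m → ℕ
    meets h = sum (λ w → inc w e * inc w h)

    spoiled : Fin m → ℕ
    spoiled h = overloaded h + meets h

    Usable : Fin m → Set
    Usable h = spoiled h ≡ 0

    usable : Fin m → ℕ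
    usable h = ⟦ spoiled h ≟ 0 ⟧

    udeg : Fin n → ℕ
    udeg p = sum (λ h → inc p h * usable h)

    low : Fin n → ℕ
    low p = ⟦ udeg p ≤? 2 ⟧

    usable-load : ∀ {h} → Usable h → 4 * load h ≤ m
    usable-load {h} us = ≮⇒≥ (⟦⟧≡0 (m <? 4 * load h) (m+n≡0⇒m≡0 (overloaded h) us))

    usable-disjoint : ∀ {h w} → Usable h → w ∈ e → ¬ w ∈ h
    usable-disjoint {h} {w} us w∈e = ⟦⟧≡0 (w ∈? h) (inc*≡0 e (m+n≡0⇒n≡0 (overloaded h) us) w∈e)

    -- Markov's inequality: the average load is at most 2n, and an overloaded edge exceeds a quarter
    -- of `m`.
    ∑-overloaded : sum overloaded ≤ 8 * n
    ∑-overloaded = *-cancelˡ-≤ m {{>-nonZero m>0}} (begin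
      m * sum overloaded                ≡⟨ *-distribˡ-sum m overloaded ⟩
      sum (λ h → m * overloaded h)      ≤⟨ sum-mono (λ h → *⟦<⟧ m (4 * load h)) ⟩
      sum (λ h → 4 * load h)            ≡⟨ sym (*-distribˡ-sum 4 load) ⟩
      4 * sum load                      ≤⟨ *-monoʳ-≤ 4 (∑-conflicts G π) ⟩
      4 * (m * (2 * n))                 ≡⟨ arith m n ⟩
      m * (8 * n)                       ∎)
      where
      open ≤-Reasoning
      arith : ∀ m n → 4 * (m * (2 * n)) ≡ m * (8 * n)
      arith = solve-∀

    ∑-meets : sum meets ≤ 2 * n
    ∑-meets = begin
      sum (λ h → sum λ w → inc w e * inc w h)
        ≡⟨ trans (∑-comm _) (sum-cong-≗ λ w → sym (*-distribˡ-sum (inc w e) _)) ⟩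
      sum (λ w → inc w e * sum (inc w))
        ≤⟨ ∑-inc-≤ e deg≤n ⟩
      2 * n ∎
      where open ≤-Reasoning

    endsLow : Fin m → ℕ
    endsLow h = sum (λ p → inc p h * low p)

    -- Double counting over vertices: a low vertex lies on at most two usable edges.
    ∑-endsLow : sum (λ h → usable h * endsLow h) ≤ 2 * n
    ∑-endsLow = begin
      sum (λ h → usable h * sum λ p → inc p h * low p)
        ≡⟨ trans (sum-cong-≗ λ h → *-distribˡ-sum (usable h) _) (∑-comm _) ⟩
      sum (λ p → sum λ h → usable h * (inc p h * low p))
        ≡⟨ (sum-cong-≗ λ p → trans (sum-cong-≗ λ h → arith (usable h) (inc p h) (low p))
              (sym (*-distribˡ-sum (low p) _))) ⟩
      sum (λ p → low p * udeg p)
        ≤⟨ sum-≤ 2 (λ p → ⟦≤⟧* (udeg p) 2) ⟩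
      n * 2 ≡⟨ *-comm n 2 ⟩
      2 * n ∎
      where
      open ≤-Reasoning
      arith : ∀ a b c → a * (b * c) ≡ c * (b * a)
      arith = solve-∀

    -- Low ends are charged to usable edges only, as `∑-endsLow` bounds them; all other edges are
    -- already counted by `spoiled`.
    unfit : Fin m → ℕ
    unfit h = spoiled h + usable h * endsLow h

    ∑-unfit : sum unfit < m
    ∑-unfit = begin-strict
      sum unfit
        ≡⟨ trans (∑-distrib-+ spoiled (λ h → usable h * endsLow h))
             (cong (_+ sum (λ h → usable h * endsLow h)) (∑-distrib-+ overloaded meets)) ⟩
      sum overloaded + sum meets + sum (λ h → usable h * endsLow h)
        ≤⟨ +-mono-≤ (+-mono-≤ ∑-overloaded ∑-meets) ∑-endsLow ⟩
      8 * n + 2 * n + 2 * n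
        ≡⟨ arith n ⟩
      12 * n
        <⟨ *-monoˡ-< n {{>-nonZero n>0}} (m≤m+n 13 187) ⟩
      200 * n
        ≤⟨ large ⟩
      m ∎
      where
      open ≤-Reasoning
      arith : ∀ n → 8 * n + 2 * n + 2 * n ≡ 12 * n
      arith = solve-∀

    fit-usable : ∀ {g} → unfit g ≡ 0 → Usable g
    fit-usable {g} = m+n≡0⇒m≡0 (spoiled g)

    fit-ends : ∀ {g} → unfit g ≡ 0 → ∀ {p} → p ∈ g → 2 < udeg p
    fit-ends {g} fit {p} p∈g = ≰⇒> (⟦⟧≡0 (udeg p ≤? 2) (inc*≡0 {low} g ends p∈g))
      where
      ends : endsLow g ≡ 0
      ends = trans (sym (trans (cong (_* endsLow g) (⟦⟧-true (spoiled g ≟ 0) (fit-usable {g} fit))) (*-identityˡ _)))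
                   (m+n≡0⇒n≡0 (spoiled g) fit)

    centre : ∃ λ g → Usable g × (∀ {p} → p ∈ g → 2 < udeg p)
    centre = let g , fit = vanishes unfit ∑-unfit in g , fit-usable {g} fit , fit-ends {g} fit

    -- `f` counts the reasons to forbid an edge. Where it falls below the product of the two
    -- indicators, the product is 1 and the value of `f` is 0.
    usableAt : ∀ {p} (f : Fin m → ℕ) → sum f < udeg p → ∃ λ h → f h ≡ 0 × p ∈ h × Usable h
    usableAt {p} f lt = let h , f< = sum-<⇒∃ {f = f} lt
                        in h , <⟦⟧*⟦⟧ (p ∈? h) (spoiled h ≟ 0) f<

    record Cherry (g : Fin m) (p : Fin n) : Set where
      field
        {h h′} : Fin m
        h≢g    : h ≢ g
        h′≢g   : h′ ≢ g
        h′≢h   : h′ ≢ h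
        p∈h    : p ∈ h
        p∈h′   : p ∈ h′
        us     : Usable h
        us′    : Usable h′

    -- Three usable edges at `p` suffice: the first choice avoids `g`, the second avoids `g` and the
    -- first.
    cherry : ∀ g {p} → 2 < udeg p → Cherry g p
    cherry g {p} 2< =
      let h , h≉g , p∈h , us = usableAt {p} (λ h → ⟦ h F.≟ g ⟧)
            (≤-trans (s≤s (≤-reflexive (sum-single g))) (<⇒≤ 2<))
          h′ , h′≉ , p∈h′ , us′ = usableAt {p} (λ h′ → ⟦ h′ F.≟ g ⟧ + ⟦ h′ F.≟ h ⟧)
            (≤-trans (s≤s (≤-reflexive (trans (∑-distrib-+ (λ h′ → ⟦ h′ F.≟ g ⟧) (λ h′ → ⟦ h′ F.≟ h ⟧))
              (cong₂ _+_ (sum-single g) (sum-single h))))) 2<)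
      in record
        { h≢g = ⟦⟧≡0 (h F.≟ g) h≉g
        ; h′≢g = ⟦⟧≡0 (h′ F.≟ g) (m+n≡0⇒m≡0 ⟦ h′ F.≟ g ⟧ h′≉)
        ; h′≢h = ⟦⟧≡0 (h′ F.≟ h) (m+n≡0⇒n≡0 ⟦ h′ F.≟ g ⟧ h′≉)
        ; p∈h = p∈h ; p∈h′ = p∈h′ ; us = us ; us′ = us′ }

    -- `l` is a load in `π`, and `c` the load after the preliminary exchange. Four times the sum of
    -- 12n and five `cost` is at most 428n, below the 600n that 3m provides.
    light : ∀ {l c} → 4 * l ≤ m → c ≤ l + 12 * n → c + 5 * cost G < m
    light {l} {c} le c≤ = *-cancelˡ-< 4 _ _ (begin-strict
      4 * (c + 5 * cost G)
        ≤⟨ *-monoʳ-≤ 4 (+-monoˡ-≤ (5 * cost G) c≤) ⟩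
      4 * (l + 12 * n + 5 * (18 * n + 1))
        ≡⟨ arith l n ⟩
      4 * l + (408 * n + 20)
        ≤⟨ +-mono-≤ le (+-monoʳ-≤ (408 * n) (*-monoʳ-≤ 20 n>0)) ⟩
      m + (408 * n + 20 * n)
        ≡⟨ cong (m +_) (sym (*-distribʳ-+ n 408 20)) ⟩
      m + 428 * n
        <⟨ +-monoʳ-< m (*-monoˡ-< n {{>-nonZero n>0}} (m≤m+n 429 171)) ⟩
      m + 600 * n
        ≡⟨ cong (m +_) (*-assoc 3 200 n) ⟩
      m + 3 * (200 * n)
        ≤⟨ +-monoʳ-≤ m (*-monoʳ-≤ 3 large) ⟩
      4 * m ∎)
      where
      open ≤-Reasoning
      arith : ∀ l n → 4 * (l + 12 * n + 5 * (18 * n + 1)) ≡ 4 * l + (408 * n + 20)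
      arith = solve-∀

  -- Repairing one collision.

  -- Two edges at an end of g share only that end, so refreshing both separates it from every
  -- vertex; this pays for giving g the label of e, about which nothing is known. The ends of e
  -- move together, hence a collision between them can only be an old one.
  module Repair (π : Labelling) {u : Fin n} {e : Fin m} (u∈e : u ∈ e) where
    open Gadget π e

    module _ {g : Fin m} (g-us : Usable g) (P : Cherry g (src g)) (Q : Cherry g (tgt g)) where
      private
        module P = Cherry P
        module Q = Cherry Q

        π₀ : Labelling
        π₀ = swap e g π

        refreshed : List (Fin m)
        refreshed = e ∷ P.h ∷ P.h′ ∷ Q.h ∷ Q.h′ ∷ []

        e≢ : ∀ {h} → Usable h → e ≢ h
        e≢ us e≡h = usable-disjoint us u∈e (subst (u ∈_) e≡h u∈e)

        e≢g : e ≢ g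
        e≢g = e≢ g-us

        -- A common edge of the two cherries would contain both ends of `g` and hence equal `g`.
        apart : ∀ {h h′} → h ≢ g → src g ∈ h → tgt g ∈ h′ → h ≢ h′
        apart h≢g p∈h q∈h refl = h≢g (simple (src≢tgt g) p∈h q∈h (inj₁ refl) (inj₂ refl))

        unique : Unique refreshed
        unique = (e≢ P.us ∷ e≢ P.us′ ∷ e≢ Q.us ∷ e≢ Q.us′ ∷ [])
               ∷ (≢-sym P.h′≢h ∷ apart P.h≢g P.p∈h Q.p∈h ∷ apart P.h≢g P.p∈h Q.p∈h′ ∷ [])
               ∷ (apart P.h′≢g P.p∈h′ Q.p∈h ∷ apart P.h′≢g P.p∈h′ Q.p∈h′ ∷ [])
               ∷ (≢-sym Q.h′≢h ∷ [])
               ∷ [] ∷ []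

        -- After the first exchange `e` carries the label of `g`, so it is the small load of `g`
        -- that counts.
        light-e : Light G π₀ 5 e
        light-e = light {load g} (usable-load g-us)
          (≤-trans (≤-reflexive (cong (conflicts π₀) (lab-swapˡ e g π))) (conflicts-swap G e≢g π (lab π g)))

        light-h : ∀ {h} → h ≢ g → Usable h → Light G π₀ 5 h
        light-h {h} h≢g us = light {load h} (usable-load us)
          (≤-trans (≤-reflexive (cong (conflicts π₀) (lab-swap π (≢-sym (e≢ us)) h≢g)))
                   (conflicts-swap G e≢g π (lab π h)))

        lights : All (Light G π₀ 5) refreshed
        lights = light-e ∷ light-h P.h≢g P.us ∷ light-h P.h′≢g P.us′
               ∷ light-h Q.h≢g Q.us ∷ light-h Q.h′≢g Q.us′ ∷ []

        module Final {π′ : Labelling} (fresh : Fresh G refreshed π₀ π′) where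
          -- A vertex `w′` colliding with an end of `g` would lie on both cherry edges at that end,
          -- and these would share two vertices.
          ∉g : ∀ {w w′} → w ≢ w′ → All (λ f → w ∈ f → w′ ∈ f) refreshed → ¬ w ∈ g
          ∉g w≢w′ (_ ∷ i ∷ i′ ∷ _) (inj₁ refl) =
            P.h′≢h (simple w≢w′ P.p∈h′ (i′ P.p∈h′) P.p∈h (i P.p∈h))
          ∉g w≢w′ (_ ∷ _ ∷ _ ∷ i ∷ i′ ∷ []) (inj₂ refl) =
            Q.h′≢h (simple w≢w′ Q.p∈h′ (i′ Q.p∈h′) Q.p∈h (i Q.p∈h))

          -- Both vertices avoid `g` and lie on the same side of `e`, so the first exchange moved
          -- their sums equally.
          undo : ∀ {w w′} → Dec (w ∈ e) → (w ∈ e → w′ ∈ e) → (w′ ∈ e → w ∈ e) →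
                 ¬ w ∈ g → ¬ w′ ∈ g → vsum π₀ w ≡ vsum π₀ w′ → vsum π w ≡ vsum π w′
          undo (yes w∈e) i _ w∉g w′∉g eq = +-cancelʳ-≡ (lab π g) _ _
            (trans (sym (vsum-swapˡ π e≢g w∈e w∉g))
              (trans (cong (_+ lab π e) eq) (vsum-swapˡ π e≢g (i w∈e) w′∉g)))
          undo (no w∉e) _ i′ w∉g w′∉g eq =
            trans (sym (vsum-swap-∉ π e≢g w∉e w∉g)) (trans eq (vsum-swap-∉ π e≢g (w∉e ∘ i′) w′∉g))

          kept : ∀ {w w′} → w ≢ w′ → vsum π′ w ≡ vsum π′ w′ → vsum π w ≡ vsum π w′
          kept {w} {w′} w≢w′ eq =
            let eq₀ , is = fresh {w} {w′} eq
                -- The implications in `Fresh` go one way; the reversed coincidence supplies the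
                -- converse.
                _ , is′  = fresh {w′} {w} (sym eq)
            in undo (w ∈? e) (All.head is) (All.head is′) (∉g w≢w′ is) (∉g (≢-sym w≢w′) is′) eq₀

      repair : ∀ {v} → ¬ v ∈ e →
        ∃ λ π′ → (∀ {w w′} → w ≢ w′ → vsum π′ w ≡ vsum π′ w′ → vsum π w ≡ vsum π w′)
               × vsum π′ u ≢ vsum π′ v
      repair {v} v∉e =
        let π′ , fresh = refresh G refreshed π₀ unique lights
        in π′ , (λ {w} {w′} → Final.kept {π′} fresh {w} {w′})
              , λ eq → v∉e (All.head (proj₂ (fresh {u} {v} eq)) u∈e)

  improve : ∀ π {u v e} → u ∈ e → ¬ v ∈ e →
    ∃ λ π′ → (∀ {w w′} → w ≢ w′ → vsum π′ w ≡ vsum π′ w′ → vsum π w ≡ vsum π w′)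
           × vsum π′ u ≢ vsum π′ v
  improve π {e = e} u∈e v∉e =
    let g , g-us , ends = Gadget.centre π e
    in Repair.repair π u∈e g-us (Gadget.cherry π e g (ends (inj₁ refl)))
         (Gadget.cherry π e g (ends (inj₂ refl))) v∉e

  -- Descent on the number of collisions.

  collisions : Labelling → ℕ
  collisions π = sum λ w → sum λ w′ → ⟦ vsum π w ≟ vsum π w′ ⟧

  -- The diagonal pairs counted by `collisions` coincide under every labelling and contribute
  -- equally to both counts; off the diagonal `kept` applies, and the pair of `u` and `v` makes the
  -- inequality strict.
  collisions-< : ∀ {π π′ u v} →
    (∀ {w w′} → w ≢ w′ → vsum π′ w ≡ vsum π′ w′ → vsum π w ≡ vsum π w′) →
    vsum π u ≡ vsum π v → vsum π′ u ≢ vsum π′ v → collisions π′ < collisions π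
  collisions-< {π} {π′} {u} {v} kept eq neq =
    sum-mono-< (λ w → sum-mono (λ w′ → le w w′)) u
      (sum-mono-< (λ w′ → le u w′) v
        (subst₂ _<_ (sym (⟦⟧-false (vsum π′ u ≟ vsum π′ v) neq))
          (sym (⟦⟧-true (vsum π u ≟ vsum π v) eq)) (s≤s z≤n)))
    where
    kept′ : ∀ w w′ → Dec (w ≡ w′) → vsum π′ w ≡ vsum π′ w′ → vsum π w ≡ vsum π w′
    kept′ w w′ (yes w≡w′) _ = cong (vsum π) w≡w′
    kept′ w w′ (no w≢w′)    = kept w≢w′
    le : ∀ w w′ → ⟦ vsum π′ w ≟ vsum π′ w′ ⟧ ≤ ⟦ vsum π w ≟ vsum π w′ ⟧
    le w w′ = ⟦⟧-mono (vsum π′ w ≟ vsum π′ w′) (vsum π w ≟ vsum π w′) (kept′ w w′ (w F.≟ w′))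

  Separated : Set
  Separated = ∀ {u v} → u ≢ v → ∃ λ e → (u ∈ e × ¬ v ∈ e) ⊎ (v ∈ e × ¬ u ∈ e)

  Antimagic : Labelling → Set
  Antimagic π = ∀ {u v} → u ≢ v → vsum π u ≢ vsum π v

  antimagic : Separated → ∃ Antimagic
  antimagic separated = go Perm.id (<-wellFounded _)
    where
    fewer : ∀ π {u v} → vsum π u ≡ vsum π v → (∃ λ e → (u ∈ e × ¬ v ∈ e) ⊎ (v ∈ e × ¬ u ∈ e)) →
            ∃ λ π′ → collisions π′ < collisions π
    fewer π eq (e , inj₁ (u∈e , v∉e)) =
      let π′ , kept , neq = improve π u∈e v∉e in π′ , collisions-< {π} {π′} kept eq neq
    fewer π eq (e , inj₂ (v∈e , u∉e)) =
      let π′ , kept , neq = improve π v∈e u∉e in π′ , collisions-< {π} {π′} kept (sym eq) neq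

    Collision : Labelling → Set
    Collision π = ∃₂ λ u v → u ≢ v × vsum π u ≡ vsum π v

    collision? : ∀ π → Dec (Collision π)
    collision? π = F.any? λ u → F.any? λ v → ¬? (u F.≟ v) ×-dec (vsum π u ≟ vsum π v)

    go : ∀ π → Acc _<_ (collisions π) → ∃ Antimagic
    descend : ∀ π → Acc _<_ (collisions π) → Dec (Collision π) → ∃ Antimagic
    go π ac = descend π ac (collision? π)
    descend π _        (no none) = π , λ {u} {v} u≢v eq → none (u , v , u≢v , eq)
    descend π (acc rs) (yes (u , v , u≢v , eq)) =
      let π′ , lt = fewer π eq (separated u≢v) in go π′ (rs lt)

-- From lists to sums over `Fin`.

lookup-injective : ∀ {a} {A : Set a} {xs : List A} → Unique xs →
                   ∀ i j → lookup xs i ≡ lookup xs j → i ≡ j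
lookup-injective (_ ∷ _)  zero    zero    _  = refl
lookup-injective (x∉ ∷ _) zero    (suc j) eq = contradiction eq (All.lookup x∉ (∈-lookup j))
lookup-injective (x∉ ∷ _) (suc i) zero    eq = contradiction (sym eq) (All.lookup x∉ (∈-lookup i))
lookup-injective (_ ∷ u)  (suc i) (suc j) eq = cong suc (lookup-injective u i j eq)

opaque
  unfolding sum

  sum-tabulate : ∀ {n} (f : Fin n → ℕ) → L.sum (tabulate f) ≡ sum f
  sum-tabulate {zero}  f = refl
  sum-tabulate {suc n} f = cong (f zero +_) (sum-tabulate (f ∘ suc))

module _ {a p} {A : Set a} {P : A → Set p} (P? : ∀ x → Dec (P x)) where

  sum-map-filter : ∀ (h : A → ℕ) → (∀ x → ¬ P x → h x ≡ 0) →
                   ∀ xs → L.sum (map h (filter P? xs)) ≡ L.sum (map h xs)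
  sum-map-filter h off []       = refl
  sum-map-filter h off (x ∷ xs) with P? x
  ... | yes _  = cong (h x +_) (sum-map-filter h off xs)
  ... | no ¬p  = trans (sum-map-filter h off xs) (cong (_+ L.sum (map h xs)) (sym (off x ¬p)))

  length-filter-sum : ∀ xs → length (filter P? xs) ≡ L.sum (map (λ x → ⟦ P? x ⟧) xs)
  length-filter-sum []       = refl
  length-filter-sum (x ∷ xs) with P? x
  ... | yes _ = cong suc (length-filter-sum xs)
  ... | no _  = length-filter-sum xs

sum-allFin : ∀ {n} (h : Fin n → ℕ) → L.sum (map h (allFin n)) ≡ sum h
sum-allFin h = trans (cong L.sum (map-tabulate (λ i → i) h)) (sum-tabulate h)

-- Numbering the edges of a simple graph.

module Bridge {n : ℕ} (G : SimpleGraph n) where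

  source target : Edge G → Fin n
  source = proj₁
  target = proj₁ ∘ proj₂

  source<target : ∀ e → source e F.< target e
  source<target (_ , _ , lt , _) = lt

  edge-≡ : ∀ {e e′ : Edge G} → source e ≡ source e′ → target e ≡ target e′ → e ≡ e′
  edge-≡ {u , v , lt , a} {_ , _ , lt′ , a′} refl refl =
    cong₂ (λ lt a → u , v , lt , a) (F.<-irrelevant lt lt′) (Decidable⇒UIP.≡-irrelevant B._≟_ a a′)

  later : Fin n → List (Fin n)
  later u = filter (λ v → u F.<? v) (nbrs G u)

  edgeTo : ∀ u {v} → v ∈ₗ later u → Edge G
  edgeTo u {v} v∈ = let v∈nbrs , u<v = ∈-filter⁻ (λ v → u F.<? v) {xs = nbrs G u} v∈
                    in u , v , u<v , proj₂ (∈-filter⁻ (λ v → adj G u v B.≟ true) {xs = allFin n} v∈nbrs)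

  edgesFrom : Fin n → List (Edge G)
  edgesFrom u = mapWith∈ (later u) (edgeTo u)

  edges : List (Edge G)
  edges = concatMap edgesFrom (allFin n)

  targets : ∀ u → map target (edgesFrom u) ≡ later u
  targets u = trans (map-mapWith∈ (later u) (edgeTo u) target) (mapWith∈-id (later u))

  -- The enumeration follows the nested list in `numEdges`; passing to the targets turns one into
  -- the other.
  length-edges : length edges ≡ numEdges G
  length-edges = trans (sym (length-map target edges))
    (cong length (trans (map-concatMap target edgesFrom (allFin n)) (concatMap-cong targets (allFin n))))

  -- Edges with a common source differ in their targets, which come from a duplicate-free list;
  -- edges from different lists differ in their sources.
  edges-unique : Unique edges
  edges-unique = Unique.concat⁺
    (All.map⁺ (All.tabulate λ {u} _ → Unique.map⁻ {f = target} (subst Unique (sym (targets u))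
      (Unique.filter⁺ _ (Unique.filter⁺ _ (Unique.allFin⁺ n))))))
    (AllPairs.map⁺ (AllPairs.map disjoint (Unique.allFin⁺ n)))
    where
    src-≡ : ∀ {u e} → e ∈ₗ edgesFrom u → source e ≡ u
    src-≡ {u} e∈ with mapWith∈⁻ (later u) (edgeTo u) e∈
    ... | _ , _ , refl = refl
    disjoint : ∀ {u u′} → u ≢ u′ → ∀ {e} → ¬ (e ∈ₗ edgesFrom u × e ∈ₗ edgesFrom u′)
    disjoint u≢u′ (e∈ , e∈′) = u≢u′ (trans (sym (src-≡ e∈)) (src-≡ e∈′))

  edges-complete : ∀ e → e ∈ₗ edges
  edges-complete e@(u , v , u<v , a) = ∈-concatMap⁺ edgesFrom (Any.map (λ { refl → e∈ }) (∈-allFin u))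
    where
    v∈ : v ∈ₗ later u
    v∈ = ∈-filter⁺ _ (∈-filter⁺ _ (∈-allFin v) a) u<v
    e∈ : e ∈ₗ edgesFrom u
    e∈ = mapWith∈⁺ (edgeTo u) (v , v∈ , edge-≡ refl refl)

  m : ℕ
  m = numEdges G

  opaque
    index : Edge G → Fin m
    index e = F.cast length-edges (Any.index (edges-complete e))

    edgeAt : Fin m → Edge G
    edgeAt i = lookup edges (F.cast (sym length-edges) i)

    edgeAt-index : ∀ e → edgeAt (index e) ≡ e
    edgeAt-index e = trans (cong (lookup edges) (F.cast-involutive (sym length-edges) length-edges _))
                           (sym (lookup-index (edges-complete e)))

    index-edgeAt : ∀ i → index (edgeAt i) ≡ i
    index-edgeAt i = trans
      (cong (F.cast length-edges) (lookup-injective edges-unique _ (F.cast (sym length-edges) i)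
        (sym (lookup-index (edges-complete (edgeAt i))))))
      (F.cast-involutive length-edges (sym length-edges) i)

  src tgt : Fin m → Fin n
  src = source ∘ edgeAt
  tgt = target ∘ edgeAt

  src<tgt : ∀ i → src i F.< tgt i
  src<tgt i = source<target (edgeAt i)

  src≢tgt : ∀ i → src i ≢ tgt i
  src≢tgt i = F.<⇒≢ (src<tgt i)

  ends-injective : ∀ {i j} → src i ≡ src j → tgt i ≡ tgt j → i ≡ j
  ends-injective {i} {j} p q = trans (sym (index-edgeAt i)) (trans (cong index (edge-≡ p q)) (index-edgeAt j))

  adj-ends : ∀ i → adj G (src i) (tgt i) ≡ true
  adj-ends i = proj₂ (proj₂ (proj₂ (edgeAt i)))

  incident? : ∀ w i → Dec (w ≡ src i ⊎ w ≡ tgt i)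
  incident? w i = (w F.≟ src i) ⊎-dec (w F.≟ tgt i)

  -- Induced sums and degrees as sums over incident edges.

  -- Reindexes ordered adjacent pairs (v , u) by edges, to compare edgeLabel with incidence sums.
  Joins : Fin n → Fin n → Fin m → Set
  Joins v u i = (v ≡ src i × u ≡ tgt i) ⊎ (v ≡ tgt i × u ≡ src i)

  joins? : ∀ v u i → Dec (Joins v u i)
  joins? v u i = ((v F.≟ src i) ×-dec (u F.≟ tgt i)) ⊎-dec ((v F.≟ tgt i) ×-dec (u F.≟ src i))

  joins-adj : ∀ {v u i} → Joins v u i → adj G v u ≡ true
  joins-adj {i = i} (inj₁ (refl , refl)) = adj-ends i
  joins-adj {i = i} (inj₂ (refl , refl)) = trans (adj-sym G _ _) (adj-ends i)

  joins-index : ∀ e i → (source e ≡ src i × target e ≡ tgt i) → i ≡ index e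
  joins-index e i (p , q) = trans (sym (index-edgeAt i)) (cong index (edge-≡ (sym p) (sym q)))

  index-joins : ∀ e {i} → i ≡ index e → source e ≡ src i × target e ≡ tgt i
  index-joins e refl = cong source (sym (edgeAt-index e)) , cong target (sym (edgeAt-index e))

  ∑-joins-edge : ∀ e {v u} (f : Edge G → ℕ) → (∀ {i} → Joins v u i → source e ≡ src i × target e ≡ tgt i) →
    (∀ {i} → source e ≡ src i × target e ≡ tgt i → Joins v u i) →
    f e ≡ sum (λ i → ⟦ joins? v u i ⟧ * f (edgeAt i))
  ∑-joins-edge e {v} {u} f to from = begin
    f e                  ≡⟨ cong f (sym (edgeAt-index e)) ⟩
    f (edgeAt (index e)) ≡⟨ sym (sum-pick (f ∘ edgeAt) (index e)) ⟩
    sum (λ i → ⟦ i F.≟ index e ⟧ * f (edgeAt i))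
      ≡⟨ (sum-cong-≗ λ i → cong (_* f (edgeAt i)) (⟦⟧-cong (i F.≟ index e) (joins? v u i)
            (from ∘ index-joins e) (joins-index e i ∘ to))) ⟩
    sum (λ i → ⟦ joins? v u i ⟧ * f (edgeAt i)) ∎
    where open ≡-Reasoning

  -- An adjacent pair is joined by exactly one edge and a nonadjacent pair by none; the wrong
  -- orientation contradicts `src<tgt`.
  edgeLabel-joins : ∀ f v u → edgeLabel G f v u ≡ sum (λ i → ⟦ joins? v u i ⟧ * f (edgeAt i))
  edgeLabel-joins f v u with B._≟_ (adj G v u) true
  ... | no ¬a = sym (trans
        (sum-cong-≗ λ i → cong (_* f (edgeAt i)) (⟦⟧-false (joins? v u i) (¬a ∘ joins-adj)))
        (trans (sum-const {m} 0) (*-zeroʳ m)))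
  ... | yes a with F.<-cmp v u
  ...   | tri< v<u _ _ = ∑-joins-edge (v , u , v<u , a) f
          (λ { (inj₁ p) → p
             ; {i} (inj₂ (refl , refl)) → contradiction (src<tgt i) (F.<-asym v<u) })
          inj₁
  ...   | tri≈ _ refl _ = contradiction (trans (sym a) (irrefl G v)) λ ()
  ...   | tri> _ _ u<v = ∑-joins-edge (u , v , u<v , _) f
          (λ { {i} (inj₁ (refl , refl)) → contradiction (src<tgt i) (F.<-asym u<v)
             ; (inj₂ (p , q)) → q , p })
          (λ (p , q) → inj₂ (q , p))

  -- An edge at `v` has exactly one other end, because its ends are distinct.
  ∑-joins : ∀ v i → sum (λ u → ⟦ joins? v u i ⟧) ≡ ⟦ incident? v i ⟧
  ∑-joins v i = aux (incident? v i)
    where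
    aux : (d : Dec (v ≡ src i ⊎ v ≡ tgt i)) → sum (λ u → ⟦ joins? v u i ⟧) ≡ ⟦ d ⟧
    aux (yes (inj₁ p)) = trans (sum-cong-≗ λ u → ⟦⟧-cong (joins? v u i) (u F.≟ tgt i)
      (λ { (inj₁ (_ , q)) → q ; (inj₂ (q , _)) → contradiction (trans (sym p) q) (src≢tgt i) })
      (λ q → inj₁ (p , q))) (sum-single (tgt i))
    aux (yes (inj₂ p)) = trans (sum-cong-≗ λ u → ⟦⟧-cong (joins? v u i) (u F.≟ src i)
      (λ { (inj₁ (q , _)) → contradiction (trans (sym q) p) (src≢tgt i) ; (inj₂ (_ , q)) → q })
      (λ q → inj₂ (p , q))) (sum-single (src i))
    aux (no ¬p) = trans (sum-cong-≗ λ u → ⟦⟧-false (joins? v u i)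
      (λ { (inj₁ (q , _)) → ¬p (inj₁ q) ; (inj₂ (q , _)) → ¬p (inj₂ q) }))
      (trans (sum-const {n} 0) (*-zeroʳ n))

  ∑-edgeLabel : ∀ f v → sum (edgeLabel G f v) ≡ sum (λ i → ⟦ incident? v i ⟧ * f (edgeAt i))
  ∑-edgeLabel f v = begin
    sum (edgeLabel G f v)
      ≡⟨ sum-cong-≗ (edgeLabel-joins f v) ⟩
    sum (λ u → sum λ i → ⟦ joins? v u i ⟧ * f (edgeAt i))
      ≡⟨ ∑-comm _ ⟩
    sum (λ i → sum λ u → ⟦ joins? v u i ⟧ * f (edgeAt i))
      ≡⟨ (sum-cong-≗ λ i → trans (sym (*-distribʳ-sum (f (edgeAt i)) _))
            (cong (_* f (edgeAt i)) (∑-joins v i))) ⟩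
    sum (λ i → ⟦ incident? v i ⟧ * f (edgeAt i)) ∎
    where open ≡-Reasoning

  inducedSum-incident : ∀ f v → inducedSum G f v ≡ sum (λ i → ⟦ incident? v i ⟧ * f (edgeAt i))
  inducedSum-incident f v = trans (sum-map-filter _ (edgeLabel G f v) off (allFin n))
    (trans (sum-allFin _) (∑-edgeLabel f v))
    where
    off : ∀ u → adj G v u ≢ true → edgeLabel G f v u ≡ 0
    off u ¬a with B._≟_ (adj G v u) true
    ... | yes a = contradiction a ¬a
    ... | no _  = refl

  adjacent? : ∀ v u → Dec (adj G v u ≡ true)
  adjacent? v u = adj G v u B.≟ true

  degree-adjacent : ∀ v → degree G v ≡ sum (λ u → ⟦ adjacent? v u ⟧)
  degree-adjacent v = trans (length-filter-sum (adjacent? v) (allFin n)) (sum-allFin _)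

  -- When every edge is labelled 1, the labels around a vertex add up to its degree, so
  -- `∑-edgeLabel` applies.
  degree-incident : ∀ v → degree G v ≡ sum (λ i → ⟦ incident? v i ⟧)
  degree-incident v = begin
    degree G v                                ≡⟨ degree-adjacent v ⟩
    sum (λ u → ⟦ adjacent? v u ⟧)             ≡⟨ sum-cong-≗ unit ⟩
    sum (edgeLabel G (λ _ → 1) v)             ≡⟨ ∑-edgeLabel _ v ⟩
    sum (λ i → ⟦ incident? v i ⟧ * 1)         ≡⟨ (sum-cong-≗ λ i → *-identityʳ _) ⟩
    sum (λ i → ⟦ incident? v i ⟧)             ∎
    where
    open ≡-Reasoning
    unit : ∀ u → ⟦ adjacent? v u ⟧ ≡ edgeLabel G (λ _ → 1) v u
    unit u with B._≟_ (adj G v u) true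
    ... | no _ = refl
    ... | yes a with F.<-cmp v u
    ...   | tri< _ _ _ = refl
    ...   | tri≈ _ refl _ = contradiction (trans (sym a) (irrefl G v)) λ ()
    ...   | tri> _ _ _ = refl

  degree≤n : ∀ v → degree G v ≤ n
  degree≤n v = ≤-trans (≤-reflexive (degree-adjacent v))
    (≤-trans (sum-≤ 1 λ u → ⟦⟧≤1 (adjacent? v u)) (≤-reflexive (*-identityʳ n)))

  -- Two distinct common vertices fix the pair of ends; opposite orientations are impossible since
  -- `src` is always below `tgt`.
  simple-ends : ∀ {i j w w′} → w ≢ w′ → w ≡ src i ⊎ w ≡ tgt i → w′ ≡ src i ⊎ w′ ≡ tgt i →
                w ≡ src j ⊎ w ≡ tgt j → w′ ≡ src j ⊎ w′ ≡ tgt j → i ≡ j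
  simple-ends {i} {j} w≢w′ p p′ q q′ with pair i p p′ | pair j q q′
    where
    pair : ∀ k → _ ≡ src k ⊎ _ ≡ tgt k → _ ≡ src k ⊎ _ ≡ tgt k → Joins _ _ k
    pair k (inj₁ a) (inj₁ b) = contradiction (trans a (sym b)) w≢w′
    pair k (inj₁ a) (inj₂ b) = inj₁ (a , b)
    pair k (inj₂ a) (inj₁ b) = inj₂ (a , b)
    pair k (inj₂ a) (inj₂ b) = contradiction (trans a (sym b)) w≢w′
  ... | inj₁ (a , b) | inj₁ (c , d) = ends-injective (trans (sym a) c) (trans (sym b) d)
  ... | inj₂ (a , b) | inj₂ (c , d) = ends-injective (trans (sym b) d) (trans (sym a) c)
  ... | inj₁ (a , b) | inj₂ (c , d) = contradiction (src<tgt j)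
        (F.<-asym (subst₂ F._<_ (trans (sym a) c) (trans (sym b) d) (src<tgt i)))
  ... | inj₂ (a , b) | inj₁ (c , d) = contradiction (src<tgt j)
        (F.<-asym (subst₂ F._<_ (trans (sym b) d) (trans (sym a) c) (src<tgt i)))

  graph : Graph n m
  graph = record
    { src = src ; tgt = tgt ; src≢tgt = src≢tgt ; simple = simple-ends
    ; deg≤n = λ w → ≤-trans (≤-reflexive (sym (degree-incident w))) (degree≤n w) }

  open Graph graph using (_∈_; inc)
  open Labellings graph

  handshake : L.sum (map (degree G) (allFin n)) ≡ m * 2
  handshake = begin
    L.sum (map (degree G) (allFin n))    ≡⟨ trans (sum-allFin _) (sum-cong-≗ degree-incident) ⟩
    sum (λ v → sum λ i → inc v i)        ≡⟨ ∑-comm _ ⟩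
    sum (λ i → sum λ v → inc v i)
      ≡⟨ (sum-cong-≗ λ i → trans (sum-cong-≗ λ v → sym (*-identityʳ _)) (∑-inc i (λ _ → 1))) ⟩
    sum {m} (λ i → 2)                    ≡⟨ sum-const {m} 2 ⟩
    m * 2                                ∎
    where open ≡-Reasoning

  adj-edge : ∀ {v u} → adj G v u ≡ true → ∃ λ i → Joins v u i
  adj-edge {v} {u} a with F.<-cmp v u
  ... | tri< v<u _ _  = index (v , u , v<u , a) , inj₁ (index-joins _ refl)
  ... | tri≈ _ refl _ = contradiction (trans (sym a) (irrefl G v)) λ ()
  ... | tri> _ _ u<v  = let p , q = index-joins (u , v , u<v , trans (adj-sym G u v) a) refl
                        in index (u , v , u<v , _) , inj₂ (q , p)

  -- Separating edges from the hypotheses on isolated edges and vertices.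

  data Local (u v : Fin n) : Set where
    elsewhere : ∀ {a} → adj G u a ≡ true → a ≢ v → Local u v
    pendant   : adj G u v ≡ true → degree G u ≡ 1 → Local u v
    isolated  : degree G u ≡ 0 → Local u v

  local : ∀ u v → Local u v
  local u v with F.any? (λ a → adjacent? u a ×-dec ¬? (a F.≟ v))
  ... | yes (a , adj-ua , a≢v) = elsewhere adj-ua a≢v
  ... | no none with adjacent? u v
  ...   | yes adj-uv = pendant adj-uv (trans (degree-adjacent u)
          (trans (sum-cong-≗ λ a → ⟦⟧-cong (adjacent? u a) (a F.≟ v) (only a) (λ { refl → adj-uv }))
                 (sum-single v)))
    where
    only : ∀ a → adj G u a ≡ true → a ≡ v
    only a adj-ua with a F.≟ v
    ... | yes a≡v = a≡v
    ... | no a≢v  = contradiction (a , adj-ua , a≢v) none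
  ...   | no ¬adj-uv = isolated (trans (degree-adjacent u)
          (trans (sum-cong-≗ λ a → ⟦⟧-false (adjacent? u a) (never a)) (trans (sum-const {n} 0) (*-zeroʳ n))))
    where
    never : ∀ a → adj G u a ≢ true
    never a adj-ua with a F.≟ v
    ... | yes refl = ¬adj-uv adj-ua
    ... | no a≢v   = none (a , adj-ua , a≢v)

  separating : ∀ {u v a} → u ≢ v → adj G u a ≡ true → a ≢ v → ∃ λ e → u ∈ e × ¬ v ∈ e
  separating u≢v adj-ua a≢v with adj-edge adj-ua
  ... | e , inj₁ (refl , refl) = e , inj₁ refl , λ { (inj₁ p) → u≢v (sym p) ; (inj₂ p) → a≢v (sym p) }
  ... | e , inj₂ (refl , refl) = e , inj₂ refl , λ { (inj₁ p) → a≢v (sym p) ; (inj₂ p) → u≢v (sym p) }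

  adj⇒degree≢0 : ∀ {u v} → adj G u v ≡ true → degree G u ≢ 0
  adj⇒degree≢0 {u} {v} a eq = ⟦⟧≡0 (adjacent? u v) (sum≡0 (trans (sym (degree-adjacent u)) eq) v) a

  -- If no edge separates the two vertices, neither has a neighbour besides the other, so they form
  -- an isolated edge or are both isolated.
  separated : NoIsolatedEdge G → AtMostOneIsolatedVertex G →
              ∀ {u v} → u ≢ v → ∃ λ e → (u ∈ e × ¬ v ∈ e) ⊎ (v ∈ e × ¬ u ∈ e)
  separated noEdge oneVertex {u} {v} u≢v with local u v | local v u
  ... | elsewhere a a≢v | _ = let e , p = separating u≢v a a≢v in e , inj₁ p
  ... | _ | elsewhere a a≢u = let e , p = separating (≢-sym u≢v) a a≢u in e , inj₂ p
  ... | pendant a d | pendant _ d′ = contradiction (a , d , d′) (noEdge u v)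
  ... | pendant a _ | isolated d   = contradiction d (adj⇒degree≢0 (trans (adj-sym G v u) a))
  ... | isolated d  | pendant a _  = contradiction d (adj⇒degree≢0 (trans (adj-sym G u v) a))
  ... | isolated d  | isolated d′  = contradiction (oneVertex u v d d′) u≢v

  -- Transfer to the original graph.

  edgeBijection : Labelling → Edge G ⤖ Fin m
  edgeBijection π = mk⤖ {to = λ e → π ⟨$⟩ʳ index e} (injective , surjective)
    where
    injective : ∀ {e e′} → π ⟨$⟩ʳ index e ≡ π ⟨$⟩ʳ index e′ → e ≡ e′
    injective {e} {e′} eq = trans (sym (edgeAt-index e)) (trans (cong edgeAt
      (trans (sym (inverseˡ π)) (trans (cong (π ⟨$⟩ˡ_) eq) (inverseˡ π)))) (edgeAt-index e′))
    surjective : ∀ i → ∃ λ e → ∀ {e′} → e′ ≡ e → π ⟨$⟩ʳ index e′ ≡ i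
    surjective i = edgeAt (π ⟨$⟩ˡ i) , λ { refl →
      trans (cong (π ⟨$⟩ʳ_) (index-edgeAt (π ⟨$⟩ˡ i))) (inverseʳ π) }

  inducedSum-vsum : ∀ π v → inducedSum G (λ e → suc (toℕ (π ⟨$⟩ʳ index e))) v ≡ vsum π v
  inducedSum-vsum π v = trans (inducedSum-incident _ v) (trans
    (sum-cong-≗ λ i → cong (λ j → inc v i * lab π j) (index-edgeAt i)) (sym (vsum-def π v)))

theorem1 : Σ ℕ λ d₀ → ∀ (n : ℕ) (G : SimpleGraph n) →
    AvgDegreeAtLeast G d₀ → NoIsolatedEdge G → AtMostOneIsolatedVertex G →
    IsAntimagic G
theorem1 = 400 , λ n G dense noEdge oneVertex →
  let open Bridge G
      large : 200 * n ≤ m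
      -- The degree sum is `m * 2`, so average degree at least 400 means at least 200 edges per
      -- vertex.
      large = *-cancelʳ-≤ (200 * n) m 2 (≤-trans
        (≤-reflexive (trans (*-comm (200 * n) 2) (sym (*-assoc 2 200 n))))
        (≤-trans dense (≤-reflexive handshake)))
      π , distinct = antimagic graph large (separated noEdge oneVertex)
  in edgeBijection π , λ u v u≢v eq →
       distinct u≢v (trans (sym (inducedSum-vsum π u)) (trans eq (inducedSum-vsum π v)))
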